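{- Let $G$ be an $n$-vertex cubic bipartite Pfaffian graph, $H$ a Hamiltonian cycle in $G$, and $e\in E(H)$. Then Thomason's lollipop method started from $H$ and $e$ terminates after at most $n$ lollipop steps.
   Context: All graphs are finite, undirected, simple. A cycle $C$ of $G$ is central if $G\setminus V(C)$ has a perfect matching; an orientation of a cycle is consistent if it is a directed cycle; an orientation $\vec G$ of $G$ (choosing one direction per edge) is Pfaffian if for every central cycle $C$ each of the two consistent orientations of $C$ shares an odd number of arcs with $\vec G$; $G$ is Pfaffian if it has a Pfaffian orientation. Thomason's lollipop method: Let $G$ be cubic with Hamiltonian cycle $H$ and $e=\{s,t\}\in E(H)$. An $e$-anchored Hamiltonian path is a Hamiltonian path of $G$ that starts at $t$ and whose first edge is $e$. A lollipop step from an $e$-anchored Hamiltonian path $Q$ ending at a vertex $u$: choose a neighbor $x\neq t$ of $u$ with $\{u,x\}\notin E(Q)$, add $\{u,x\}$ to $Q$ to obtain a lollipop (a connected graph with one degree-1 vertex $t$, one degree-3 vertex $x$, all others of degree 2); then delete the unique edge $\{v,x\}$ of this lollipop with $v\notin\{u,t\}$ whose removal leaves an $e$-anchored Hamiltonian path $Q'$ (ending at $v$). The method starts by deleting from $H$ the edge $\{t,u\}$ with $u\neq s$, obtaining the $e$-anchored Hamiltonian path $Q_0$ ending at $u$, and then performs lollipop steps $Q_0\to Q_1\to Q_2\to\cdots$, where each step $Q_i\to Q_{i+1}$ (for $i\ge1$) is the lollipop step other than the one returning to $Q_{i-1}$; it terminates at the first $Q_h$ ($h\ge1$) whose end vertex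 other than $t$ is a neighbor of $t$. The number of lollipop steps is $h$. -}

module Defs where

open import Data.Nat using (ℕ; zero; suc; _≤_; _<_; _%_)
open import Data.Fin using (Fin)
open import Data.Bool using (Bool; true; false)
open import Data.List using (List; []; _∷_; _++_; [_]; length; filterᵇ; allFin; concatMap; reverse)
open import Data.List.Membership.Propositional using (_∈_; _∉_)
open import Data.List.Relation.Unary.Unique.Propositional using (Unique)
open import Data.List.Relation.Unary.All using (All)
open import Data.Product using (Σ; ∃; ∃₂; _×_; _,_)
open import Data.Sum using (_⊎_)
open import Relation.Nullary using (¬_)
open import Relation.Binary.PropositionalEquality using (_≡_; _≢_)
open import Function.Bundles using (_⇔_)

record Graph (n : ℕ) : Set where
  field
    adj    : Fin n → Fin n → Bool
    sym    : ∀ a b → adj a b ≡ adj b a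
    irrefl : ∀ a → adj a a ≡ false
open Graph public

module _ {n : ℕ} (G : Graph n) where

  Adj : Fin n → Fin n → Set
  Adj a b = adj G a b ≡ true

  degree : Fin n → ℕ
  degree v = length (filterᵇ (adj G v) (allFin n))

  Cubic : Set
  Cubic = ∀ v → degree v ≡ 3

  Bipartite : Set
  Bipartite = Σ (Fin n → Bool) λ c → ∀ a b → Adj a b → c a ≢ c b

module _ {A : Set} where

  Consec : List A → A → A → Set
  Consec Q a b = ∃₂ λ (L R : List A) → Q ≡ L ++ a ∷ b ∷ R

  EdgeP : List A → A → A → Set
  EdgeP Q a b = Consec Q a b ⊎ Consec Q b a

  close : List A → List A
  close []       = []
  close (x ∷ xs) = x ∷ xs ++ [ x ]

  EdgeC : List A → A → A → Set
  EdgeC C a b = EdgeP (close C) a b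

  UEq : A → A → A → A → Set
  UEq a b c d = (a ≡ c × b ≡ d) ⊎ (a ≡ d × b ≡ c)

  pairs : List A → List (A × A)
  pairs (x ∷ y ∷ r) = (x , y) ∷ pairs (y ∷ r)
  pairs _           = []

  EndsAt : List A → A → Set
  EndsAt Q u = Σ (List A) λ L → Q ≡ L ++ [ u ]

Odd : ℕ → Set
Odd k = k % 2 ≡ 1

module _ {n : ℕ} (G : Graph n) where

  IsCycle : List (Fin n) → Set
  IsCycle C = (3 ≤ length C) × Unique C × (∀ a b → Consec (close C) a b → Adj G a b)

  IsHamCycle : List (Fin n) → Set
  IsHamCycle C = IsCycle C × (∀ v → v ∈ C)

  -- a perfect matching of G ∖ V(C): a list of pairwise disjoint edges of G
  -- whose vertices are exactly the vertices not on C
  Central : List (Fin n) → Set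
  Central C = Σ (List (Fin n × Fin n)) λ M →
      All (λ { (a , b) → Adj G a b }) M
    × Unique (concatMap (λ { (a , b) → a ∷ b ∷ [] }) M)
    × (∀ v → (v ∈ concatMap (λ { (a , b) → a ∷ b ∷ [] }) M) ⇔ (v ∉ C))

  -- an orientation: D a b ≡ true means the arc a → b;
  -- each edge gets exactly one direction, non-edges none
  IsOrientation : (Fin n → Fin n → Bool) → Set
  IsOrientation D = ∀ a b →
      (D a b ≡ true → Adj G a b)
    × (Adj G a b → (D a b ≡ true ⊎ D b a ≡ true))
    × ¬ (D a b ≡ true × D b a ≡ true)

  shared : (Fin n → Fin n → Bool) → List (Fin n) → ℕ
  shared D C = length (filterᵇ (λ { (a , b) → D a b }) (pairs (close C)))

  IsPfaffianOrientation : (Fin n → Fin n → Bool) → Set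
  IsPfaffianOrientation D = IsOrientation D ×
    (∀ C → IsCycle C → Central C → Odd (shared D C) × Odd (shared D (reverse C)))

  Pfaffian : Set
  Pfaffian = Σ (Fin n → Fin n → Bool) IsPfaffianOrientation

  IsHamPath : List (Fin n) → Set
  IsHamPath Q = Unique Q × (∀ v → v ∈ Q) × (∀ a b → Consec Q a b → Adj G a b)

  -- e-anchored Hamiltonian path, e = {s,t}: starts at t, first edge {t,s}
  Anchored : Fin n → Fin n → List (Fin n) → Set
  Anchored s t Q = IsHamPath Q × Σ (List (Fin n)) λ r → Q ≡ t ∷ s ∷ r

  IsInitial : List (Fin n) → Fin n → Fin n → List (Fin n) → Set
  IsInitial H s t Q = Anchored s t Q × Σ (Fin n) λ u →
      u ≢ s × EdgeC H t u × EndsAt Q u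
    × (∀ a b → EdgeP Q a b ⇔ (EdgeC H a b × ¬ UEq a b t u))

  LollipopStep : Fin n → Fin n → List (Fin n) → List (Fin n) → Set
  LollipopStep s t Q Q' = Anchored s t Q × Anchored s t Q' ×
    Σ (Fin n) λ u → Σ (Fin n) λ x → Σ (Fin n) λ v →
        EndsAt Q u × Adj G u x × x ≢ t × ¬ EdgeP Q u x
      × v ≢ u × v ≢ t × EdgeP Q v x
      × EndsAt Q' v
      × (∀ a b → EdgeP Q' a b ⇔ ((EdgeP Q a b ⊎ UEq a b u x) × ¬ UEq a b v x))

  LollipopRun : List (Fin n) → Fin n → Fin n → ℕ → (ℕ → List (Fin n)) → Set
  LollipopRun H s t h Q =
      1 ≤ h
    × IsInitial H s t (Q 0)
    × (∀ i → i < h → LollipopStep s t (Q i) (Q (suc i)))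
    × (∀ i → suc i < h → Q (suc (suc i)) ≢ Q i)
    × (∀ i → 1 ≤ i → i < h → ∀ w → EndsAt (Q i) w → ¬ Adj G t w)
    × (Σ (Fin n) λ w → EndsAt (Q h) w × Adj G t w)

{-# OPTIONS --safe #-}

-- Let D be a Pfaffian orientation and let f be a potential of D along the initial path Q₀, that
-- is, D(y,z) = f(y) + f(z) mod 2 on its arcs. Call τ(a,b) = f(b) + D(b,a) the sign at a vertex a
-- coloured like t of its edge ab. On Q₀ the two path edges at such a vertex have opposite signs.
-- A lollipop step that adds ux and deletes vx closes the cycle x v … u, which is central, since
-- the part of the path before x has an even number of vertices; as this cycle has an odd number
-- of arcs in common with D, ux and vx have the same sign. Hence opposite signs persist on all
-- paths, and each x switches between the same two of its edges throughout the run.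
--
-- So the ends u₀, u₁, … and the vertices x₀, x₁, … form a walk in which xᵢ always links the same
-- two ends. As long as no end repeats, all vertices of the walk are distinct. If uⱼ = uᵢ with
-- i < j, the moves x₀, …, xᵢ₋₁ can be undone in reverse order, which leads back to u₀, a
-- neighbour of t. For the first such j the 2j − 1 vertices u₀, x₀, u₁, …, uⱼ₋₁ are distinct, so
-- h ≤ j + i ≤ 2j − 1 ≤ n.
module Submission where

open import Defs renaming (sym to adj-sym)
open import Data.Nat using (ℕ; zero; suc; _≤_; _<_; _+_; s≤s; z≤n)
import Data.Nat.Properties as ℕ
open import Data.Bool using (Bool; true; false; not; _xor_; if_then_else_)
open import Data.Bool.Properties using (not-involutive; ¬-not; not-¬; T-≡; xor-assoc; xor-comm; xor-same)
import Data.Bool.Properties as Bool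
open import Data.Nat.Solver using (module +-*-Solver)
open import Data.Bool.Solver using (module xor-∧-Solver)
open import Data.Fin using (Fin)
open import Data.Fin.Properties using (_≟_)
open import Data.List using (List; []; _∷_; _++_; [_]; length; filterᵇ; allFin; concatMap; reverse; initLast; _∷ʳ′_)
open import Data.List.Properties using (++-assoc; ++-identityʳ; length-++; length-tabulate; reverse-++; unfold-reverse; reverse-involutive; ∷-injective; ∷ʳ-injective)
open import Data.List.Membership.Propositional using (_∈_; _∉_; find; lose)
open import Data.List.Membership.Propositional.Properties using (∈-++⁺ˡ; ∈-++⁺ʳ; ∈-++⁻; ∈-∃++; ∈-allFin; ∈-filter⁺; ∈-filter⁻)
open import Data.List.Relation.Binary.Subset.Propositional using (_⊆_)
open import Data.List.Relation.Binary.Permutation.Propositional using (_↭_; ↭-sym; ↭-trans; prep; ↭⇒↭ₛ)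
open import Data.List.Relation.Binary.Permutation.Propositional.Properties using (∈-resp-↭; ↭-length; ↭-reverse; ++-comm; ++⁺ˡ)
import Data.List.Relation.Binary.Permutation.Setoid.Properties as Permₛ
open import Data.List.Relation.Unary.Any using (here; there; any?)
open import Data.List.Relation.Unary.All as All using (All; []; _∷_)
import Data.List.Relation.Unary.All.Properties as All
open import Data.List.Relation.Unary.AllPairs using ([]; _∷_)
open import Data.List.Relation.Unary.Unique.Propositional using (Unique)
import Data.List.Relation.Unary.Unique.Propositional.Properties as Unique
open import Data.Product using (Σ; ∃; ∃₂; _×_; _,_; proj₁; proj₂)
open import Data.Sum using (_⊎_; inj₁; inj₂; [_,_]′; swap; map₁)
open import Data.Empty using (⊥-elim)
open import Function using (_∘_; id)
open import Function.Bundles using (_⇔_; mk⇔; Equivalence)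
open import Relation.Nullary using (¬_; Dec; yes; no; does; ¬?; _×-dec_)
open import Relation.Nullary.Decidable using (T?; dec-true; dec-false)
open import Relation.Binary.PropositionalEquality hiding ([_])

open Equivalence using (to; from)

-- Duplicate-free lists, paths and cycles

module _ {A : Set} where

  Unique-resp-↭ : ∀ {xs ys : List A} → xs ↭ ys → Unique xs → Unique ys
  Unique-resp-↭ = Permₛ.Unique-resp-↭ (setoid A) ∘ ↭⇒↭ₛ

  unique-head : ∀ {x : A} {xs} → Unique (x ∷ xs) → x ∉ xs
  unique-head = Unique.Unique[x∷xs]⇒x∉xs

  unique-tail : ∀ {x : A} {xs} → Unique (x ∷ xs) → Unique xs
  unique-tail (_ ∷ u) = u

  unique-cons : ∀ {x : A} {xs} → x ∉ xs → Unique xs → Unique (x ∷ xs)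
  unique-cons x∉ u = All.¬Any⇒All¬ _ x∉ ∷ u

  unique-++ʳ : ∀ (xs : List A) {ys} → Unique (xs ++ ys) → Unique ys
  unique-++ʳ []       u       = u
  unique-++ʳ (x ∷ xs) (_ ∷ u) = unique-++ʳ xs u

  unique-++ˡ : ∀ (xs : List A) {ys} → Unique (xs ++ ys) → Unique xs
  unique-++ˡ []       u = []
  unique-++ˡ (x ∷ xs) u =
    unique-cons (unique-head u ∘ ∈-++⁺ˡ) (unique-++ˡ xs (unique-tail u))

  unique-disjoint : ∀ (xs : List A) {ys y} → Unique (xs ++ ys) → y ∈ xs → y ∉ ys
  unique-disjoint (x ∷ xs) u (here refl) y∈ = unique-head u (∈-++⁺ʳ xs y∈)
  unique-disjoint (x ∷ xs) u (there p)   y∈ = unique-disjoint xs (unique-tail u) p y∈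

  unique-length : ∀ {xs ys : List A} → Unique xs → xs ⊆ ys → length xs ≤ length ys
  unique-length {[]}     u sub = z≤n
  unique-length {x ∷ xs} u sub with ∈-∃++ (sub (here refl))
  ... | P , R , refl = begin
      suc (length xs)           ≤⟨ s≤s (unique-length (unique-tail u) sub′) ⟩
      suc (length (P ++ R))     ≡⟨ cong suc (length-++ P) ⟩
      suc (length P + length R) ≡⟨ ℕ.+-suc (length P) (length R) ⟨
      length P + suc (length R) ≡⟨ length-++ P ⟨
      length (P ++ x ∷ R)       ∎
    where
    open ℕ.≤-Reasoning
    sub′ : xs ⊆ P ++ R
    sub′ y∈ with ∈-++⁻ P (sub (there y∈))
    ... | inj₁ p           = ∈-++⁺ˡ p
    ... | inj₂ (here refl) = ⊥-elim (unique-head u y∈)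
    ... | inj₂ (there p)   = ∈-++⁺ʳ P p

  consec-++ˡ : ∀ {xs ys : List A} {a b} → Consec xs a b → Consec (xs ++ ys) a b
  consec-++ˡ {ys = ys} (L , R , refl) = L , R ++ ys , ++-assoc L _ ys

  consec-++ʳ : ∀ (xs : List A) {ys a b} → Consec ys a b → Consec (xs ++ ys) a b
  consec-++ʳ xs (L , R , refl) = xs ++ L , R , sym (++-assoc xs L _)

  consec-∷ : ∀ {y : A} {xs a b} → Consec (y ∷ xs) a b →
             (a ≡ y × ∃ λ R → xs ≡ b ∷ R) ⊎ Consec xs a b
  consec-∷ ([]    , R , refl) = inj₁ (refl , R , refl)
  consec-∷ (_ ∷ L , R , refl) = inj₂ (L , R , refl)

  ¬consec-[] : ∀ {a b : A} → ¬ Consec [] a b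
  ¬consec-[] ([]    , _ , ())
  ¬consec-[] (_ ∷ _ , _ , ())

  ¬consec-[-] : ∀ {x a b : A} → ¬ Consec [ x ] a b
  ¬consec-[-] c with consec-∷ c
  ... | inj₁ (_ , _ , ())
  ... | inj₂ c′ = ¬consec-[] c′

  -- The junction `m` is kept in both pieces, so that no consecutive pair is lost at the cut.
  consec-split : ∀ (xs : List A) {m ys a b} → Consec (xs ++ m ∷ ys) a b →
                 Consec (xs ++ [ m ]) a b ⊎ Consec (m ∷ ys) a b
  consec-split []           c = inj₂ c
  consec-split (x ∷ [])     c with consec-∷ c
  ... | inj₁ (refl , _ , refl) = inj₁ ([] , [] , refl)
  ... | inj₂ c′                = inj₂ c′
  consec-split (x ∷ y ∷ xs) c =
    [ (λ { (refl , _ , refl) → inj₁ ([] , _ , refl) })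
    , map₁ (consec-++ʳ [ x ]) ∘ consec-split (y ∷ xs) ]′ (consec-∷ c)

  consec-join : ∀ (xs : List A) {m ys a b} →
                Consec (xs ++ [ m ]) a b → Consec (xs ++ m ∷ ys) a b
  consec-join xs {m} {ys} {a} {b} c =
    subst (λ l → Consec l a b) (++-assoc xs [ m ] ys) (consec-++ˡ c)

  consec-reverse : ∀ {xs : List A} {a b} → Consec xs a b → Consec (reverse xs) b a
  consec-reverse {a = a} {b} (L , R , refl) = reverse R , reverse L , (begin
    reverse (L ++ a ∷ b ∷ R)             ≡⟨ reverse-++ L (a ∷ b ∷ R) ⟩
    reverse (a ∷ b ∷ R) ++ reverse L     ≡⟨ cong (_++ reverse L) (reverse-++ (a ∷ b ∷ []) R) ⟩
    (reverse R ++ b ∷ a ∷ []) ++ reverse L ≡⟨ ++-assoc (reverse R) _ _ ⟩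
    reverse R ++ b ∷ a ∷ reverse L ∎)
    where open ≡-Reasoning

  consec-∈ˡ : ∀ {xs : List A} {a b} → Consec xs a b → a ∈ xs
  consec-∈ˡ (L , R , refl) = ∈-++⁺ʳ L (here refl)

  consec-∈ʳ : ∀ {xs : List A} {a b} → Consec xs a b → b ∈ xs
  consec-∈ʳ (L , R , refl) = ∈-++⁺ʳ L (there (here refl))

  consec-unique-succ : ∀ {xs : List A} {a b b′} → Unique xs →
                       Consec xs a b → Consec xs a b′ → b ≡ b′
  consec-unique-succ {[]}     u c c′ = ⊥-elim (¬consec-[] c)
  consec-unique-succ {x ∷ xs} u c c′ with consec-∷ c | consec-∷ c′
  ... | inj₁ (refl , _ , refl) | inj₁ (_ , _ , refl) = refl
  ... | inj₁ (refl , _ , refl) | inj₂ d′             = ⊥-elim (unique-head u (consec-∈ˡ d′))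
  ... | inj₂ d                 | inj₁ (refl , _)     = ⊥-elim (unique-head u (consec-∈ˡ d))
  ... | inj₂ d                 | inj₂ d′             = consec-unique-succ (unique-tail u) d d′

  unique-reverse : ∀ {xs : List A} → Unique xs → Unique (reverse xs)
  unique-reverse {xs} = Unique-resp-↭ (↭-sym (↭-reverse xs))

  consec-unique-pred : ∀ {xs : List A} {a b b′} → Unique xs →
                       Consec xs b a → Consec xs b′ a → b ≡ b′
  consec-unique-pred u c c′ =
    consec-unique-succ (unique-reverse u) (consec-reverse c) (consec-reverse c′)

  ¬consec-last : ∀ (xs : List A) {u b} → Unique (xs ++ [ u ]) → ¬ Consec (xs ++ [ u ]) u b
  ¬consec-last []       un c = ¬consec-[-] c
  ¬consec-last (x ∷ xs) un c with consec-∷ c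
  ... | inj₁ (refl , _) = unique-head un (∈-++⁺ʳ xs (here refl))
  ... | inj₂ c′         = ¬consec-last xs (unique-tail un) c′

  edge-sym : ∀ {xs : List A} {a b} → EdgeP xs a b → EdgeP xs b a
  edge-sym = swap

  edge-∈ˡ : ∀ {xs : List A} {a b} → EdgeP xs a b → a ∈ xs
  edge-∈ˡ = [ consec-∈ˡ , consec-∈ʳ ]′

  edge-∈ʳ : ∀ {xs : List A} {a b} → EdgeP xs a b → b ∈ xs
  edge-∈ʳ = edge-∈ˡ ∘ edge-sym

  edge-++ʳ : ∀ (xs : List A) {ys a b} → EdgeP ys a b → EdgeP (xs ++ ys) a b
  edge-++ʳ xs = [ inj₁ ∘ consec-++ʳ xs , inj₂ ∘ consec-++ʳ xs ]′

  edge-join : ∀ (xs : List A) {m ys a b} → EdgeP (xs ++ [ m ]) a b → EdgeP (xs ++ m ∷ ys) a b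
  edge-join xs = [ inj₁ ∘ consec-join xs , inj₂ ∘ consec-join xs ]′

  edge-split : ∀ (xs : List A) {m ys a b} → EdgeP (xs ++ m ∷ ys) a b →
               EdgeP (xs ++ [ m ]) a b ⊎ EdgeP (m ∷ ys) a b
  edge-split xs (inj₁ c) = [ inj₁ ∘ inj₁ , inj₂ ∘ inj₁ ]′ (consec-split xs c)
  edge-split xs (inj₂ c) = [ inj₁ ∘ inj₂ , inj₂ ∘ inj₂ ]′ (consec-split xs c)

  edge-reverse⁺ : ∀ {xs : List A} {a b} → EdgeP xs a b → EdgeP (reverse xs) a b
  edge-reverse⁺ = [ inj₂ ∘ consec-reverse , inj₁ ∘ consec-reverse ]′

  edge-reverse⁻ : ∀ {xs : List A} {a b} → EdgeP (reverse xs) a b → EdgeP xs a b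
  edge-reverse⁻ {xs} e = subst (λ l → EdgeP l _ _) (reverse-involutive xs) (edge-reverse⁺ e)

  edge-∷⁻ : ∀ {x y : A} {xs a b} → EdgeP (x ∷ y ∷ xs) a b → UEq a b x y ⊎ EdgeP (y ∷ xs) a b
  edge-∷⁻ (inj₁ c) with consec-∷ c
  ... | inj₁ (refl , _ , refl) = inj₁ (inj₁ (refl , refl))
  ... | inj₂ c′                = inj₂ (inj₁ c′)
  edge-∷⁻ (inj₂ c) with consec-∷ c
  ... | inj₁ (refl , _ , refl) = inj₁ (inj₂ (refl , refl))
  ... | inj₂ c′                = inj₂ (inj₂ c′)

  edge-∷⁺ : ∀ {x y : A} {xs a b} → UEq a b x y ⊎ EdgeP (y ∷ xs) a b → EdgeP (x ∷ y ∷ xs) a b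
  edge-∷⁺ (inj₁ (inj₁ (refl , refl))) = inj₁ ([] , _ , refl)
  edge-∷⁺ (inj₁ (inj₂ (refl , refl))) = inj₂ ([] , _ , refl)
  edge-∷⁺ {x} (inj₂ e)                = edge-++ʳ [ x ] e

  -- Adding ux and deleting vx reverses the part of the path after x.
  edge-flip : ∀ (P : List A) {x v u S S′} → reverse (v ∷ S) ≡ u ∷ S′ →
              Unique (P ++ x ∷ v ∷ S) → u ≢ v → ∀ a b →
              EdgeP (P ++ x ∷ reverse (v ∷ S)) a b ⇔
                ((EdgeP (P ++ x ∷ v ∷ S) a b ⊎ UEq a b u x) × ¬ UEq a b v x)
  edge-flip P {x} {v} {u} {S} {S′} rev un u≢v a b = mk⇔ fwd bwd
    where
    xvS = x ∷ v ∷ S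
    x∉vS : x ∉ v ∷ S
    x∉vS = unique-head (unique-++ʳ P un)
    v∉Px : v ∉ P ++ [ x ]
    v∉Px p = unique-disjoint (P ++ [ x ])
               (subst Unique (sym (++-assoc P [ x ] (v ∷ S))) un) p (here refl)
    e-v : ∀ {xs} → v ∉ xs → EdgeP xs a b → ¬ UEq a b v x
    e-v v∉ e (inj₁ (refl , refl)) = v∉ (edge-∈ˡ e)
    e-v v∉ e (inj₂ (refl , refl)) = v∉ (edge-∈ʳ e)
    e-x : ∀ {xs} → x ∉ xs → EdgeP xs a b → ¬ UEq a b v x
    e-x x∉ e (inj₁ (refl , refl)) = x∉ (edge-∈ʳ e)
    e-x x∉ e (inj₂ (refl , refl)) = x∉ (edge-∈ˡ e)
    fwd : EdgeP (P ++ x ∷ reverse (v ∷ S)) a b →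
          (EdgeP (P ++ xvS) a b ⊎ UEq a b u x) × ¬ UEq a b v x
    fwd e with edge-split P e
    ... | inj₁ e₁ = inj₁ (edge-join P e₁) , e-v v∉Px e₁
    ... | inj₂ e₂ with edge-∷⁻ (subst (λ l → EdgeP (x ∷ l) a b) rev e₂)
    ...   | inj₁ (inj₁ (refl , refl)) = inj₂ (inj₂ (refl , refl)) ,
              λ { (inj₁ (refl , _)) → x∉vS (here refl) ; (inj₂ (_ , p)) → u≢v p }
    ...   | inj₁ (inj₂ (refl , refl)) = inj₂ (inj₁ (refl , refl)) ,
              λ { (inj₁ (p , _)) → u≢v p ; (inj₂ (_ , refl)) → x∉vS (here refl) }
    ...   | inj₂ e₃ = inj₁ (edge-++ʳ P (edge-++ʳ [ x ] e₄)) , e-x x∉vS e₄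
      where
      e₄ : EdgeP (v ∷ S) a b
      e₄ = edge-reverse⁻ (subst (λ l → EdgeP l a b) (sym rev) e₃)
    bwd : (EdgeP (P ++ xvS) a b ⊎ UEq a b u x) × ¬ UEq a b v x →
          EdgeP (P ++ x ∷ reverse (v ∷ S)) a b
    bwd (inj₂ q , _) = edge-++ʳ P (subst (λ l → EdgeP (x ∷ l) a b) (sym rev)
                         (edge-∷⁺ (inj₁ (swap q))))
    bwd (inj₁ e , nv) with edge-split P e
    ... | inj₁ e₁ = edge-join P e₁
    ... | inj₂ e₂ with edge-∷⁻ e₂
    ...   | inj₁ (inj₁ q) = ⊥-elim (nv (inj₂ q))
    ...   | inj₁ (inj₂ q) = ⊥-elim (nv (inj₁ q))
    ...   | inj₂ e₃ = edge-++ʳ P (edge-++ʳ [ x ] (edge-reverse⁺ e₃))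

  -- Rotation and reversal of cycles

  edge-cyclic-swap : ∀ (X R : List A) {a b : A} → EdgeC (X ++ R) a b → EdgeC (R ++ X) a b
  edge-cyclic-swap []       R       {a} {b} e = subst (λ l → EdgeC l a b) (sym (++-identityʳ R)) e
  edge-cyclic-swap (x ∷ X)  []      {a} {b} e = subst (λ l → EdgeC l a b) (++-identityʳ (x ∷ X)) e
  -- The closed list is cut at `r` into a stretch from `x` to `r` and one from `r` back to `x`; in
  -- the opposite order these two glue at `x`.
  edge-cyclic-swap (x ∷ X)  (r ∷ R) e
    with edge-split (x ∷ X) (subst (λ l → EdgeP (x ∷ l) _ _) (++-assoc X (r ∷ R) [ x ]) e)
  ... | inj₁ e₁ = subst (λ l → EdgeP (r ∷ l) _ _) (sym (++-assoc R (x ∷ X) [ r ]))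
                    (edge-++ʳ (r ∷ R) e₁)
  ... | inj₂ e₂ = subst (λ l → EdgeP (r ∷ l) _ _) (sym (++-assoc R (x ∷ X) [ r ]))
                    (edge-join (r ∷ R) e₂)

  -- The permutation transports distinctness and coverage of the vertices, the equivalence
  -- transports adjacency; together they are insensitive to rotation and reversal.
  SameCycle : List A → List A → Set
  SameCycle C C′ = C ↭ C′ × (∀ a b → EdgeC C a b ⇔ EdgeC C′ a b)

  sameCycle-trans : ∀ {C C′ C″} → SameCycle C C′ → SameCycle C′ C″ → SameCycle C C″
  sameCycle-trans (p , e) (p′ , e′) = ↭-trans p p′ ,
    λ a b → mk⇔ (to (e′ a b) ∘ to (e a b)) (from (e a b) ∘ from (e′ a b))

  sameCycle-rotate : ∀ (X R : List A) → SameCycle (R ++ X) (X ++ R)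
  sameCycle-rotate X R = ++-comm R X ,
    λ a b → mk⇔ (edge-cyclic-swap R X) (edge-cyclic-swap X R)

  close-reverse : ∀ (h : A) hs → close (h ∷ reverse hs) ≡ reverse (close (h ∷ hs))
  close-reverse h hs = sym (trans (unfold-reverse h (hs ++ [ h ]))
                                  (cong (_++ [ h ]) (reverse-++ hs [ h ])))

  sameCycle-reverse : ∀ (h : A) hs → SameCycle (h ∷ reverse hs) (h ∷ hs)
  sameCycle-reverse h hs = prep h (↭-reverse hs) , λ a b →
    mk⇔ (edge-reverse⁻ ∘ subst (λ l → EdgeP l a b) (close-reverse h hs))
        (subst (λ l → EdgeP l a b) (sym (close-reverse h hs)) ∘ edge-reverse⁺)

  rotate-to-arc : ∀ (C : List A) {s t} → 3 ≤ length C → Consec (close C) t s →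
                  ∃ λ r → SameCycle (t ∷ s ∷ r) C
  rotate-to-arc (h ∷ hs) {s} {t} 3≤ (X , Y , eq) with initLast Y
  -- Here the arc is the closing one: `t` is the last vertex and `s` the head.
  ... | [] with ∷ʳ-injective (h ∷ hs) (X ++ [ t ]) (trans eq (sym (++-assoc X [ t ] [ s ])))
  ...   | eq₁ , refl with X
  ...     | x ∷ X′ with refl ← proj₁ (∷-injective eq₁) =
              X′ , subst (SameCycle _) (sym eq₁) (sameCycle-rotate (h ∷ X′) [ t ])
  ...     | [] with refl ← eq₁ = ⊥-elim (ℕ.<⇒≱ 3≤ (s≤s z≤n))
  rotate-to-arc (h ∷ hs) {s} {t} 3≤ (X , .(Y′ ++ [ y ]) , eq) | Y′ ∷ʳ′ y =
    Y′ ++ X , subst (SameCycle _) (sym eq₁) (sameCycle-rotate X (t ∷ s ∷ Y′))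
    where
    eq₁ : h ∷ hs ≡ X ++ t ∷ s ∷ Y′
    eq₁ = proj₁ (∷ʳ-injective (h ∷ hs) (X ++ t ∷ s ∷ Y′)
                  (trans eq (sym (++-assoc X (t ∷ s ∷ Y′) [ y ]))))

  rotate-to-edge : ∀ (C : List A) {s t} → 3 ≤ length C → EdgeC C s t →
                   ∃ λ r → SameCycle (t ∷ s ∷ r) C
  rotate-to-edge C        3≤ (inj₂ c) = rotate-to-arc C 3≤ c
  -- The cycle runs from `s` to `t`, so it is reversed first, with its head kept in place.
  rotate-to-edge (h ∷ hs) 3≤ (inj₁ c)
    with rotate-to-arc (h ∷ reverse hs)
           (subst (3 ≤_) (sym (↭-length (proj₁ (sameCycle-reverse h hs)))) 3≤)
           (subst (λ l → Consec l _ _) (sym (close-reverse h hs)) (consec-reverse c))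
  ... | r , same = r , sameCycle-trans same (sameCycle-reverse h hs)

  endsAt-[-] : ∀ {x u : A} → EndsAt [ x ] u → x ≡ u
  endsAt-[-] ([]    , refl)     = refl
  endsAt-[-] (_ ∷ [] , ())
  endsAt-[-] (_ ∷ _ ∷ _ , ())

  endsAt-∷ : ∀ {x y : A} {l u} → EndsAt (x ∷ y ∷ l) u → EndsAt (y ∷ l) u
  endsAt-∷ (_ ∷ L , eq) = L , proj₂ (∷-injective eq)

  endsAt-∷⁺ : ∀ {x : A} {l u} → EndsAt l u → EndsAt (x ∷ l) u
  endsAt-∷⁺ {x} (L , refl) = x ∷ L , refl

  endsAt-suffix : ∀ (P : List A) {y l u} → EndsAt (P ++ y ∷ l) u → EndsAt (y ∷ l) u
  endsAt-suffix []          e = e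
  endsAt-suffix (_ ∷ [])    e = endsAt-∷ e
  endsAt-suffix (_ ∷ q ∷ P) e = endsAt-suffix (q ∷ P) (endsAt-∷ e)

  endsAt-++ : ∀ (P : List A) {l u} → EndsAt l u → EndsAt (P ++ l) u
  endsAt-++ P (L , refl) = P ++ L , sym (++-assoc P L _)

  endsAt-unique : ∀ {l : List A} {u u′} → EndsAt l u → EndsAt l u′ → u ≡ u′
  endsAt-unique (L , refl) (L′ , eq) = proj₂ (∷ʳ-injective L L′ eq)

-- Parity of the arcs along a list

flux : {A : Set} → (A → A → Bool) → List A → Bool
flux D (x ∷ y ∷ l) = D x y xor flux D (y ∷ l)
flux D _           = false

parity : ℕ → Bool
parity zero    = false
parity (suc k) = not (parity k)

odd⇒parity : ∀ k → Odd k → parity k ≡ true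
odd⇒parity (suc zero)    _ = refl
odd⇒parity (suc (suc k)) o = trans (not-involutive _) (odd⇒parity k o)

module _ {A : Set} (D : A → A → Bool) where

  parity-filter-∷ : (g : A × A → Bool) → ∀ e es →
                    parity (length (filterᵇ g (e ∷ es))) ≡ g e xor parity (length (filterᵇ g es))
  parity-filter-∷ g e es with g e
  ... | true  = refl
  ... | false = refl

  -- `g` stands for the anonymous function in `shared`, which agrees with `D` only pointwise.
  parity-filter : (g : A × A → Bool) → (∀ x y → g (x , y) ≡ D x y) →
                  ∀ l → parity (length (filterᵇ g (pairs l))) ≡ flux D l
  parity-filter g g≡ []          = refl
  parity-filter g g≡ (_ ∷ [])    = refl
  parity-filter g g≡ (x ∷ y ∷ l) = trans (parity-filter-∷ g (x , y) (pairs (y ∷ l)))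
    (cong₂ _xor_ (g≡ x y) (parity-filter g g≡ (y ∷ l)))

  flux-snoc : ∀ L u x → flux D (L ++ u ∷ x ∷ []) ≡ flux D (L ++ [ u ]) xor D u x
  flux-snoc []          u x = xor-comm (D u x) false
  flux-snoc (y ∷ [])    u x = solve 2 (λ p q → p :+ (q :+ con false) := (p :+ con false) :+ q)
                                refl (D y u) (D u x)
    where open xor-∧-Solver
  flux-snoc (y ∷ z ∷ L) u x = trans (cong (D y z xor_) (flux-snoc (z ∷ L) u x))
                                (sym (xor-assoc (D y z) _ _))

  -- Built from the last vertex backwards: each new head gets the value that its one arc forces, and
  -- as it does not occur later, no earlier choice is overwritten.
  potential : ∀ Q → Unique Q → (A-≟ : ∀ (x y : A) → Dec (x ≡ y)) →
              ∃ λ (f : A → Bool) → ∀ {y z} → Consec Q y z → f y xor f z ≡ D y z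
  potential []          u _≟A_ = (λ _ → false) , λ c → ⊥-elim (¬consec-[] c)
  potential (x ∷ [])    u _≟A_ = (λ _ → false) , λ c → ⊥-elim (¬consec-[-] c)
  potential (x ∷ l@(y ∷ _)) u _≟A_ with potential l (unique-tail u) _≟A_
  ... | f , pot = f′ , pot′
    where
    f′ : A → Bool
    f′ z = if does (z ≟A x) then D x y xor f y else f z
    f′-x : f′ x ≡ D x y xor f y
    f′-x rewrite dec-true (x ≟A x) refl = refl
    f′-l : ∀ {z} → z ∈ l → f′ z ≡ f z
    f′-l {z} z∈ rewrite dec-false (z ≟A x) (λ { refl → unique-head u z∈ }) = refl
    pot′ : ∀ {a b} → Consec (x ∷ l) a b → f′ a xor f′ b ≡ D a b
    pot′ c with consec-∷ c
    ... | inj₁ (refl , _ , refl) = trans (cong₂ _xor_ f′-x (f′-l (here refl)))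
            (solve 2 (λ p q → (p :+ q) :+ q := p) refl (D x y) (f y))
      where open xor-∧-Solver
    ... | inj₂ c′ = trans (cong₂ _xor_ (f′-l (consec-∈ˡ c′)) (f′-l (consec-∈ʳ c′))) (pot c′)

≢-≢⇒≡ : ∀ {x y z : Bool} → x ≢ y → z ≢ y → x ≡ z
≢-≢⇒≡ x≢y z≢y = trans (¬-not x≢y) (sym (¬-not z≢y))

-- Neighbours in cubic graphs, matchings along a path

module _ {n : ℕ} (G : Graph n) where

  adj-comm : ∀ {a b} → Adj G a b → Adj G b a
  adj-comm {a} {b} e = trans (adj-sym G b a) e

  adj-≢ : ∀ {a b} → Adj G a b → a ≢ b
  adj-≢ {a} e refl with trans (sym e) (irrefl G a)
  ... | ()

  private
    neighbours : Fin n → List (Fin n)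
    neighbours v = filterᵇ (adj G v) (allFin n)

    ∈-neighbours⁺ : ∀ {v x} → Adj G v x → x ∈ neighbours v
    ∈-neighbours⁺ {v} {x} e = ∈-filter⁺ (T? ∘ adj G v) (∈-allFin x) (from T-≡ e)

    ∈-neighbours⁻ : ∀ {v x} → x ∈ neighbours v → Adj G v x
    ∈-neighbours⁻ {v} x∈ = to T-≡ (proj₂ (∈-filter⁻ (T? ∘ adj G v) {xs = allFin n} x∈))

    neighbours-unique : ∀ v → Unique (neighbours v)
    neighbours-unique v = Unique.filter⁺ (T? ∘ adj G v) (Unique.allFin⁺ n)

  cubic-≤3 : Cubic G → ∀ {v xs} → Unique xs → (∀ {x} → x ∈ xs → Adj G v x) → length xs ≤ 3
  cubic-≤3 cub {v} u adjs =
    ℕ.≤-trans (unique-length u (∈-neighbours⁺ ∘ adjs)) (ℕ.≤-reflexive (cub v))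

  cubic-third : Cubic G → ∀ v p q → ∃ λ x → Adj G v x × x ≢ p × x ≢ q
  cubic-third cub v p q with any? (λ x → ¬? (x ≟ p) ×-dec ¬? (x ≟ q)) (neighbours v)
  ... | yes any with x , x∈ , x≢p , x≢q ← find any = x , ∈-neighbours⁻ x∈ , x≢p , x≢q
  ... | no none = ⊥-elim (ℕ.<⇒≱ (s≤s ℕ.≤-refl) (ℕ.≤-trans (ℕ.≤-reflexive (sym (cub v)))
                    (unique-length {ys = p ∷ q ∷ []} (neighbours-unique v) sub)))
    where
    sub : neighbours v ⊆ p ∷ q ∷ []
    sub {x} x∈ with x ≟ p | x ≟ q
    ... | yes x≡p | _       = here x≡p
    ... | no _    | yes x≡q = there (here x≡q)
    ... | no x≢p  | no x≢q  = ⊥-elim (none (lose x∈ (x≢p , x≢q)))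

  -- The function f is quantified since Central flattens M by an anonymous function.
  pairing : ∀ {c : Fin n → Bool} → (∀ a b → Adj G a b → c a ≢ c b) → ∀ P x →
            (∀ {a b} → Consec (P ++ [ x ]) a b → Adj G a b) →
            (∀ {y ys} → P ++ [ x ] ≡ y ∷ ys → c y ≡ c x) →
            ∃ λ M → (∀ {a b} → (a , b) ∈ M → Adj G a b)
                  × (∀ f → (∀ a b → f (a , b) ≡ a ∷ b ∷ []) → concatMap f M ≡ P)
  pairing bip []          x adj hd = [] , (λ ()) , λ _ _ → refl
  -- A single vertex left over would be adjacent to `x` and have its colour.
  pairing bip (p ∷ [])    x adj hd = ⊥-elim (bip p x (adj ([] , [] , refl)) (hd refl))
  pairing {c} bip (p ∷ q ∷ P) x adj hd
    with pairing {c} bip P x (adj ∘ consec-++ʳ (p ∷ q ∷ [])) hd′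
    where
    hd′ : ∀ {y ys} → P ++ [ x ] ≡ y ∷ ys → c y ≡ c x
    hd′ {y} {ys} eq = trans
      (≢-≢⇒≡ (λ e → bip q y (adj (subst (λ l → Consec (p ∷ q ∷ l) q y) (sym eq) ([ p ] , ys , refl))) (sym e))
             (bip p q (adj ([] , _ , refl))))
      (hd refl)
  ... | M , adjM , flat = (p , q) ∷ M
      , (λ { (here refl) → adj ([] , _ , refl) ; (there e) → adjM e })
      , λ f f≡ → cong₂ _++_ (f≡ p q) (flat f f≡)

-- Signs of edges and central cycles

module Lollipop {n : ℕ} (G : Graph n)
  (c : Fin n → Bool) (bip : ∀ a b → Adj G a b → c a ≢ c b)
  (D : Fin n → Fin n → Bool) (pfaffian : IsPfaffianOrientation G D)
  (f : Fin n → Bool) (s t : Fin n) where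

  reverse-arc : ∀ {a b} → Adj G a b → D a b ≡ not (D b a)
  reverse-arc {a} {b} e with D a b in ab | D b a in ba | proj₁ pfaffian a b
  ... | true  | true  | _ , _ , asym = ⊥-elim (asym (refl , refl))
  ... | true  | false | _            = refl
  ... | false | true  | _            = refl
  ... | false | false | _ , total , _ with total e
  ...   | inj₁ ()
  ...   | inj₂ ()

  τ : Fin n → Fin n → Bool
  τ a b = f b xor D b a

  -- Only the colour of `t` is constrained: the vertex `x` at which a move exchanges edges has this
  -- colour, the ends of the paths do not.
  Alternating : List (Fin n) → Set
  Alternating Q = ∀ {a b b′} → c a ≡ c t → b ≢ b′ → EdgeP Q a b → EdgeP Q a b′ → τ a b ≢ τ a b′

  -- At a vertex a coloured like `t` between b and b′, opposite signs mean D b a + D a b′ = f b + f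
  -- b′ mod 2. Summed over such pairs of edges this telescopes. `sub` keeps `Q` fixed while the
  -- recursion passes to suffixes.
  flux-alternating : ∀ {Q} → (∀ {a b} → EdgeP Q a b → Adj G a b) → Alternating Q →
    ∀ b l {u} → Unique (b ∷ l) → (∀ {y z} → Consec (b ∷ l) y z → EdgeP Q y z) →
    c b ≢ c t → EndsAt (b ∷ l) u → c u ≢ c t → flux D (b ∷ l) ≡ f b xor f u
  flux-alternating adj alt b [] un sub cb end cu with refl ← endsAt-[-] end =
    sym (xor-same (f b))
  flux-alternating adj alt b (a ∷ []) un sub cb end cu with refl ← endsAt-[-] (endsAt-∷ end) =
    ⊥-elim (bip b a (adj (sub ([] , _ , refl))) (≢-≢⇒≡ cb cu))
  flux-alternating adj alt b (a ∷ b′ ∷ l) {u} un sub cb end cu = begin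
      D b a xor (D a b′ xor flux D (b′ ∷ l))
        ≡⟨ cong (λ z → D b a xor (D a b′ xor z)) (flux-alternating adj alt b′ l
             (unique-tail (unique-tail un)) (sub ∘ consec-++ʳ (b ∷ a ∷ [])) cb′
             (endsAt-∷ (endsAt-∷ end)) cu) ⟩
      D b a xor (D a b′ xor (f b′ xor f u))
        ≡⟨ cong (λ z → D b a xor (z xor (f b′ xor f u))) (reverse-arc ab′) ⟩
      D b a xor (not (D b′ a) xor (f b′ xor f u))
        -- In the solver, `con true :+ z` stands for `not z`.
        ≡⟨ solve 5 (λ p q r v w → q :+ ((con true :+ w) :+ (r :+ v))
                := (p :+ v) :+ (con true :+ ((p :+ q) :+ (r :+ w))))
             refl (f b) (D b a) (f b′) (f u) (D b′ a) ⟩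
      (f b xor f u) xor not (τ a b xor τ a b′)
        ≡⟨ cong (λ z → (f b xor f u) xor not (z xor τ a b′)) (¬-not differ) ⟩
      (f b xor f u) xor not (not (τ a b′) xor τ a b′)
        ≡⟨ solve 3 (λ p v z → (p :+ v) :+ (con true :+ ((con true :+ z) :+ z)) := p :+ v)
             refl (f b) (f u) (τ a b′) ⟩
      f b xor f u ∎
    where
    open ≡-Reasoning
    open xor-∧-Solver
    ba : EdgeP _ b a
    ba = sub ([] , _ , refl)
    ab′ : Adj G a b′
    ab′ = adj (sub ([ b ] , _ , refl))
    ca : c a ≡ c t
    ca = ≢-≢⇒≡ (bip a b (adj-comm G (adj ba))) (cb ∘ sym)
    cb′ : c b′ ≢ c t
    cb′ e = bip a b′ ab′ (trans ca (sym e))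
    differ : τ a b ≢ τ a b′
    differ = alt ca (λ { refl → unique-head un (there (here refl)) })
                 (edge-sym ba) (sub ([ b ] , _ , refl))

  edge-adj : ∀ {Q} → IsHamPath G Q → ∀ {a b} → EdgeP Q a b → Adj G a b
  edge-adj (_ , _ , adj) (inj₁ e) = adj _ _ e
  edge-adj (_ , _ , adj) (inj₂ e) = adj-comm G (adj _ _ e)

  -- The cycle x v … u closed by the chord ux is central: what precedes x on the path is
  -- matched along the path.
  chord-sign : ∀ P x v S {u} → IsHamPath G (P ++ x ∷ v ∷ S) → Alternating (P ++ x ∷ v ∷ S) →
    (∀ {y ys} → P ++ [ x ] ≡ y ∷ ys → c y ≡ c x) → c x ≡ c t →
    EndsAt (v ∷ S) u → v ≢ u → Adj G u x → τ x v ≡ τ x u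
  chord-sign P x v S {u} ham@(un , all , adj) alt hd cx end@(L , vS≡) v≢u ux = begin
      f v xor D v x
        -- Under the outer `not` stands the parity of the arcs round the cycle: the edge xv, the
        -- stretch from v to u, the chord ux. By `total` it is odd.
        ≡⟨ solve 4 (λ p q r w → p :+ q := (r :+ w) :+ (con true :+ ((con true :+ q) :+ ((p :+ r) :+ w))))
             refl (f v) (D v x) (f u) (D u x) ⟩
      τ x u xor not (not (D v x) xor ((f v xor f u) xor D u x))
        ≡⟨ cong (λ z → τ x u xor not z) total ⟩
      τ x u xor false
        ≡⟨ xor-comm (τ x u) false ⟩
      τ x u ∎
    where
    open ≡-Reasoning
    open xor-∧-Solver
    C = x ∷ v ∷ S
    unC : Unique C
    unC = unique-++ʳ P un
    cu : c u ≢ c t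
    cu e = bip u x ux (trans e (sym cx))
    vx : Adj G v x
    vx = adj-comm G (adj _ _ (P , S , refl))
    cv : c v ≢ c t
    cv e = bip v x vx (trans e (sym cx))
    close≡ : close C ≡ x ∷ L ++ u ∷ x ∷ []
    close≡ = cong (x ∷_) (trans (cong (_++ [ x ]) vS≡) (++-assoc L [ u ] [ x ]))
    length-C : 3 ≤ length C
    length-C = length≥ S end
      where
      length≥ : ∀ S → EndsAt (v ∷ S) u → 3 ≤ length (x ∷ v ∷ S)
      length≥ []      e = ⊥-elim (v≢u (endsAt-[-] e))
      length≥ (_ ∷ _) e = s≤s (s≤s (s≤s z≤n))
    consec-C : ∀ a b → Consec (close C) a b → Adj G a b
    consec-C a b d with consec-split (x ∷ L) (subst (λ l → Consec l a b) close≡ d)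
    ... | inj₁ d₁ = adj a b (consec-++ʳ P (subst (λ l → Consec (x ∷ l) a b) (sym vS≡) d₁))
    ... | inj₂ d₂ with consec-∷ d₂
    ...   | inj₁ (refl , _ , refl) = ux
    ...   | inj₂ d₃                = ⊥-elim (¬consec-[-] d₃)
    cycle : IsCycle G C
    cycle = length-C , unC , consec-C
    central : Central G C
    central with pairing G bip P x (λ d → adj _ _ (consec-join P d)) hd
    ... | M , adjM , flat = M
        , All.tabulate (λ e → adjM e)
        , subst Unique (sym (flat _ λ _ _ → refl)) (unique-++ˡ P un)
        , λ w → mk⇔
            (λ w∈ → unique-disjoint P un (subst (w ∈_) (flat _ λ _ _ → refl) w∈))
            (λ w∉ → subst (w ∈_) (sym (flat _ λ _ _ → refl))
                      ([ id , ⊥-elim ∘ w∉ ]′ (∈-++⁻ P (all w))))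
    total : not (D v x) xor ((f v xor f u) xor D u x) ≡ true
    total = begin
      not (D v x) xor ((f v xor f u) xor D u x)
        ≡⟨ cong₂ (λ y z → y xor (z xor D u x)) (sym (reverse-arc (adj-comm G vx)))
             (sym (flux-alternating (edge-adj ham) alt v S (unique-tail unC)
                     (edge-++ʳ P ∘ edge-++ʳ [ x ] ∘ inj₁) cv end cu)) ⟩
      D x v xor (flux D (v ∷ S) xor D u x)
        ≡⟨ cong (λ l → D x v xor (flux D l xor D u x)) vS≡ ⟩
      D x v xor (flux D (L ++ [ u ]) xor D u x)
        ≡⟨ cong (D x v xor_) (flux-snoc D L u x) ⟨
      D x v xor flux D (L ++ u ∷ x ∷ [])
        ≡⟨ cong (λ l → D x v xor flux D l) (proj₂ (∷-injective close≡)) ⟨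
      flux D (close C)
        ≡⟨ parity-filter D _ (λ _ _ → refl) (close C) ⟨
      parity (shared G D C)
        ≡⟨ odd⇒parity (shared G D C) (proj₁ (proj₂ pfaffian C cycle central)) ⟩
      true ∎

  -- Lollipop moves

  record PathTo (u : Fin n) (Q : List (Fin n)) : Set where
    field
      anchored    : Anchored G s t Q
      ends        : EndsAt Q u
      end-colour  : c u ≢ c t
      alternating : Alternating Q
    ham : IsHamPath G Q
    ham = proj₁ anchored
    unique : Unique Q
    unique = proj₁ ham
  open PathTo

  -- `LollipopStep` hides u, x and v behind existentials; here they are parameters, so that later
  -- arguments can refer to the edges exchanged.
  record Move (Q : List (Fin n)) (u x v : Fin n) (Q′ : List (Fin n)) : Set where
    field
      step       : LollipopStep G s t Q Q′
      path       : PathTo v Q′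
      v≢u        : v ≢ u
      removed    : EdgeP Q v x
      equal-sign : τ x v ≡ τ x u
      edges      : ∀ a b → EdgeP Q′ a b ⇔ ((EdgeP Q a b ⊎ UEq a b u x) × ¬ UEq a b v x)
  open Move

  move : ∀ {Q u x} → Adj G s t → PathTo u Q → Adj G u x → x ≢ t → ¬ EdgeP Q u x →
         ∃₂ λ v Q′ → Move Q u x v Q′
  move {Q} {u} {x} st p ux x≢t new with ∈-∃++ (proj₁ (proj₂ (ham p)) x)
  -- If nothing followed `x`, it would be the end `u`, which is not adjacent to itself.
  ... | P , [] , refl = ⊥-elim (adj-≢ G ux (endsAt-unique (ends p) (P , refl)))
  ... | P , v ∷ S , refl = v , Q′ , record
      { step = anchored p , anchored′ , u , x , v , ends p , ux , x≢t , new , v≢u′ , v≢t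
             , removed′ , ends′ , edges′
      ; path = record { anchored = anchored′ ; ends = ends′ ; end-colour = cv
                      ; alternating = alternating′ }
      ; v≢u = v≢u′ ; removed = removed′ ; equal-sign = sign ; edges = edges′ }
    where
    Q′ = P ++ x ∷ reverse (v ∷ S)
    cx : c x ≡ c t
    cx = ≢-≢⇒≡ (bip u x ux ∘ sym) (end-colour p ∘ sym)
    removed′ : EdgeP Q v x
    removed′ = inj₂ (P , S , refl)
    v≢u′ : v ≢ u
    v≢u′ refl = new removed′
    vx : Adj G v x
    vx = edge-adj (ham p) removed′
    cv : c v ≢ c t
    cv e = bip v x vx (trans e (sym cx))
    v≢t : v ≢ t
    v≢t refl = cv refl
    end-vS : EndsAt (v ∷ S) u
    end-vS = endsAt-∷ (endsAt-suffix P (ends p))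
    L = proj₁ end-vS
    rev : reverse (v ∷ S) ≡ u ∷ reverse L
    rev = trans (cong reverse (proj₂ end-vS)) (reverse-++ L [ u ])
    edges′ = edge-flip P rev (unique p) (v≢u′ ∘ sym)
    ends′ : EndsAt Q′ v
    ends′ = endsAt-++ P (endsAt-∷⁺ (reverse S , unfold-reverse v S))
    adj′ : ∀ {a b} → EdgeP Q′ a b → Adj G a b
    adj′ {a} {b} e with to (edges′ a b) e
    ... | inj₁ e′ , _                   = edge-adj (ham p) e′
    ... | inj₂ (inj₁ (refl , refl)) , _ = ux
    ... | inj₂ (inj₂ (refl , refl)) , _ = adj-comm G ux
    perm : Q ↭ Q′
    perm = ++⁺ˡ P (prep x (↭-sym (↭-reverse (v ∷ S))))
    ham′ : IsHamPath G Q′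
    ham′ = Unique-resp-↭ perm (unique p)
         , (λ w → ∈-resp-↭ perm (proj₁ (proj₂ (ham p)) w))
         , λ a b → adj′ ∘ inj₁
    -- The first two vertices stay: `x` differs from `t` by assumption and from `s` by colour.
    begins : ∀ P → (∃ λ r → P ++ x ∷ v ∷ S ≡ t ∷ s ∷ r) →
             (∃ λ r → P ++ x ∷ reverse (v ∷ S) ≡ t ∷ s ∷ r)
           × (∀ {y ys} → P ++ [ x ] ≡ y ∷ ys → c y ≡ c x)
    begins []          (_ , refl) = ⊥-elim (x≢t refl)
    begins (_ ∷ [])    (_ , refl) = ⊥-elim (bip s t st cx)
    begins (_ ∷ _ ∷ P) (_ , refl) = (_ , refl) , λ { refl → sym cx }
    anchored′ : Anchored G s t Q′
    anchored′ = ham′ , proj₁ (begins P (proj₂ (anchored p)))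
    sign : τ x v ≡ τ x u
    sign = chord-sign P x v S (ham p) (alternating p) (proj₂ (begins P (proj₂ (anchored p))))
             cx end-vS v≢u′ ux
    new-edge : ∀ {a b} → c a ≡ c t → UEq a b u x → a ≡ x × b ≡ u
    new-edge ca (inj₁ (refl , _)) = ⊥-elim (end-colour p ca)
    new-edge ca (inj₂ eqs)        = eqs
    alternating′ : Alternating Q′
    -- Two old edges still differ in sign. The new edge occurs only at `x`, where it takes over the
    -- sign of the removed edge xv.
    alternating′ {a} {b} {b′} ca b≢b′ e e′ with to (edges′ a b) e | to (edges′ a b′) e′
    ... | inj₁ o , _ | inj₁ o′ , _ = alternating p ca b≢b′ o o′
    ... | inj₂ q , _ | inj₂ q′ , _ =
        ⊥-elim (b≢b′ (trans (proj₂ (new-edge ca q)) (sym (proj₂ (new-edge ca q′)))))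
    ... | inj₁ o , k | inj₂ q′ , _ with refl , refl ← new-edge ca q′ =
        λ eq → alternating p ca (λ { refl → k (inj₂ (refl , refl)) }) o (edge-sym removed′)
                 (trans eq (sym sign))
    alternating′ {a} {b} {b′} ca b≢b′ e e′ | inj₂ q , _ | inj₁ o′ , k′ with refl , refl ← new-edge ca q =
        λ eq → alternating p ca (λ { refl → k′ (inj₂ (refl , refl)) }) o′ (edge-sym removed′)
                 (trans (sym eq) (sym sign))

  -- Effect of a move on edges and chains

  open import Data.List.Membership.DecPropositional (_≟_ {n}) using (_∈?_)

  removed-gone : ∀ {Q u x v Q′} → Move Q u x v Q′ → ¬ EdgeP Q′ v x
  removed-gone m e = proj₂ (to (edges m _ _) e) (inj₁ (refl , refl))

  -- The edge up of `Q⁻` is missing in `Q`, and the move adds only ux with x different from p; hence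
  -- `Q′` lacks it too.
  no-return : ∀ {Q⁻ Q u x v Q′ p} → Move Q u x v Q′ → Adj G u x →
              EdgeP Q⁻ u p → ¬ EdgeP Q u p → p ≢ x → Q′ ≢ Q⁻
  no-return m ux e⁻ gone p≢x refl with proj₁ (to (edges m _ _) e⁻)
  ... | inj₁ e               = gone e
  ... | inj₂ (inj₁ (_ , eq)) = p≢x eq
  ... | inj₂ (inj₂ (eq , _)) = adj-≢ G ux eq

  chord-colour : ∀ {Q u x} → PathTo u Q → Adj G u x → c x ≡ c t
  chord-colour p ux = ≢-≢⇒≡ (bip _ _ ux ∘ sym) (end-colour p ∘ sym)

  -- Of the ends of the exchanged edges ux and vx, only `x` is coloured like `t`; so at every other
  -- vertex of that colour the path edges persist.
  keep⁺ : ∀ {Q u x v Q′ z b} → Move Q u x v Q′ → c z ≡ c t → z ≢ x → EdgeP Q z b → EdgeP Q′ z b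
  keep⁺ m cz z≢x e = from (edges m _ _)
    (inj₁ e , [ (λ { (refl , _) → end-colour (path m) cz }) , z≢x ∘ proj₁ ]′)

  keep⁻ : ∀ {Q u x v Q′ z b} → PathTo u Q → Move Q u x v Q′ → c z ≡ c t → z ≢ x →
          EdgeP Q′ z b → EdgeP Q z b
  keep⁻ p m cz z≢x e with proj₁ (to (edges m _ _) e)
  ... | inj₁ e′                = e′
  ... | inj₂ (inj₁ (refl , _)) = ⊥-elim (end-colour p cz)
  ... | inj₂ (inj₂ (refl , _)) = ⊥-elim (z≢x refl)

  -- Chain Q w (x ∷ y ∷ …) records the walk by which the end vertex came to w, most recent
  -- move first: y was the end before the move that added yx and removed xw. The path Q
  -- is still such that all these moves can be undone one after the other.
  data Chain (Q : List (Fin n)) : Fin n → List (Fin n) → Set where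
    base : ∀ {w} → Adj G t w → Chain Q w []
    link : ∀ {w x y zs} → Adj G w x → Adj G y x → c x ≡ c t →
           EdgeP Q x y → ¬ EdgeP Q x w → τ x y ≡ τ x w →
           Chain Q y zs → Chain Q w (x ∷ y ∷ zs)

  keep-chain : ∀ {Q u x v Q′ w zs} → PathTo u Q → Move Q u x v Q′ → x ∉ zs →
               Chain Q w zs → Chain Q′ w zs
  keep-chain p m x∉ (base tw) = base tw
  keep-chain p m x∉ (link wz yz cz e ne sg ch) =
    link wz yz cz (keep⁺ m cz z≢x e) (ne ∘ keep⁻ p m cz z≢x) sg
         (keep-chain p m (x∉ ∘ there ∘ there) ch)
    where z≢x = λ { refl → x∉ (here refl) }

  -- Linking vertices, coloured like `t`, alternate with ends in a chain. The colour of `v` makes it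
  -- an end, and there the chain can be cut.
  subchain : ∀ {Q w zs v} → Chain Q w zs → c v ≢ c t → v ∈ zs →
             ∃₂ λ F zs′ → zs ≡ F ++ v ∷ zs′ × Chain Q v zs′
  subchain (link _ _ cx _ _ _ _) cv (here refl)         = ⊥-elim (cv cx)
  subchain (link _ _ _ _ _ _ ch) cv (there (here refl)) = _ ∷ [] , _ , refl , ch
  subchain (link _ _ _ _ _ _ ch) cv (there (there v∈)) with subchain ch cv v∈
  ... | F , zs′ , refl , ch′ = _ ∷ _ ∷ F , zs′ , refl , ch′

  -- Runs and their reversal

  adjacent? : ∀ a b → Dec (Adj G a b)
  adjacent? a b = adj G a b Bool.≟ true

  -- The rest of a run, after its step from Q⁻ to Q.
  data Tail : List (Fin n) → List (Fin n) → ℕ → Set where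
    stop : ∀ {Q⁻ Q u} → EndsAt Q u → Adj G t u → Tail Q⁻ Q 0
    go   : ∀ {Q⁻ Q Q′ u h} → EndsAt Q u → ¬ Adj G t u → LollipopStep G s t Q Q′ →
           Q′ ≢ Q⁻ → Tail Q Q′ h → Tail Q⁻ Q (suc h)

  -- Index 0 is the path before the step that precedes the tail, so a tail of length `h` gives a run
  -- of `suc h` steps. Beyond the end the last path is repeated as a default.
  sequence : ∀ {Q⁻ Q h} → Tail Q⁻ Q h → ℕ → List (Fin n)
  sequence {Q⁻} _        zero    = Q⁻
  sequence {Q = Q} (stop _ _) (suc _) = Q
  sequence (go _ _ _ _ T) (suc i) = sequence T i

  sequence-one : ∀ {Q⁻ Q h} (T : Tail Q⁻ Q h) → sequence T 1 ≡ Q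
  sequence-one (stop _ _)     = refl
  sequence-one (go _ _ _ _ _) = refl

  sequence-step : ∀ {Q⁻ Q h} (T : Tail Q⁻ Q h) → LollipopStep G s t Q⁻ Q →
                  ∀ i → i < suc h → LollipopStep G s t (sequence T i) (sequence T (suc i))
  sequence-step T               st zero    _         = subst (LollipopStep G s t _) (sym (sequence-one T)) st
  sequence-step (go _ _ st′ _ T) _ (suc i) (s≤s i<h) = sequence-step T st′ i i<h

  sequence-no-return : ∀ {Q⁻ Q h} (T : Tail Q⁻ Q h) → ∀ i → suc i < suc h →
                       sequence T (suc (suc i)) ≢ sequence T i
  sequence-no-return (stop _ _)      _       (s≤s ())
  sequence-no-return (go _ _ _ ne T) zero    _         eq = ne (trans (sym (sequence-one T)) eq)
  sequence-no-return (go _ _ _ _ T)  (suc i) (s≤s i<h) = sequence-no-return T i i<h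

  sequence-interior : ∀ {Q⁻ Q h} (T : Tail Q⁻ Q h) → ∀ i → 1 ≤ i → i < suc h →
                      ∀ w → EndsAt (sequence T i) w → ¬ Adj G t w
  sequence-interior (stop _ _)            (suc zero) _ (s≤s ())
  sequence-interior (stop _ _)            (suc (suc i)) _ (s≤s ())
  sequence-interior (go end nadj _ _ _) (suc zero) _ _ w end′ tw =
    nadj (subst (Adj G t) (endsAt-unique end′ end) tw)
  sequence-interior (go _ _ _ _ T) (suc (suc i)) _ (s≤s i<h) = sequence-interior T (suc i) (s≤s z≤n) i<h

  sequence-final : ∀ {Q⁻ Q h} (T : Tail Q⁻ Q h) →
                   Σ (Fin n) λ w → EndsAt (sequence T (suc h)) w × Adj G t w
  sequence-final (stop end tu)    = _ , end , tu
  sequence-final (go _ _ _ _ T) = sequence-final T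

  tail-run : ∀ {H Q⁻ Q h} → IsInitial G H s t Q⁻ → LollipopStep G s t Q⁻ Q → (T : Tail Q⁻ Q h) →
             LollipopRun G H s t (suc h) (sequence T)
  tail-run init st T = s≤s z≤n , init , sequence-step T st , sequence-no-return T
                     , sequence-interior T , sequence-final T

  -- The next step must add the edge from `v` to the top linking vertex z of the chain. It removes
  -- the path edge at z of the same sign, which is the one to the earlier end y; so the last link is
  -- undone. This goes on until the end is a neighbour of `t`, at the latest at `base`. As `x` is
  -- not in the chain, the first step is not a return.
  retreat : ∀ {Q⁻ Q v x zs} → Adj G s t → PathTo v Q → Chain Q v zs → Unique (v ∷ zs) → x ∉ zs →
            EdgeP Q⁻ v x → ¬ EdgeP Q v x → ∃ λ h → Tail Q⁻ Q h × h + h ≤ length zs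
  retreat {v = v} st p ch un x∉ e⁻ gone with adjacent? t v
  retreat st p ch un x∉ e⁻ gone | yes tv = 0 , stop (ends p) tv , z≤n
  retreat st p (base tv) un x∉ e⁻ gone | no ntv = ⊥-elim (ntv tv)
  retreat st p (link {x = z} {y} {zs} vz yz cz e ne sg ch) un x∉ e⁻ gone | no ntv
    with move st p vz (λ { refl → ntv (adj-comm G vz) }) (ne ∘ edge-sym)
  ... | y′ , Q′ , m with y′ ≟ y
  -- Otherwise z would have two path edges of equal sign.
  ...   | no y′≢y = ⊥-elim (alternating p cz y′≢y (edge-sym (removed m)) e
                              (trans (equal-sign m) (sym sg)))
  ...   | yes refl with retreat st (path m) (keep-chain p m z∉ ch) (unique-tail (unique-tail un)) z∉
                          (removed m) (removed-gone m)
    where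
    z∉ : z ∉ zs
    z∉ = unique-head (unique-tail un) ∘ there
  ...     | h , T , h≤ = suc h
          , go (ends p) ntv (step m) (no-return m vz e⁻ gone (λ { refl → x∉ (here refl) })) T
          -- Each undone move uses up two entries of the chain.
          , s≤s (ℕ.≤-trans (ℕ.≤-reflexive (ℕ.+-suc h h)) (s≤s h≤))

  -- Forward search and the bound on its length

  entry : List (Fin n) → Fin n
  entry []      = t
  entry (x ∷ _) = x

  -- Otherwise x would have the four neighbours u, v and the two ends that it joined before.
  fresh : ∀ {Q u x v Q′ y zs} → Cubic G → PathTo u Q → Adj G u x → Move Q u x v Q′ →
          Chain Q y zs → Unique (y ∷ zs) → (y ≡ u → x ≢ entry zs) → u ∉ zs → v ∉ zs → x ∉ zs
  fresh cub p ux m (link {w = y} {y = y₁} yx y₁x cx e ne sg ch) un hd u∉ v∉ (here refl) =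
    ℕ.<⇒≱ ℕ.≤-refl (cubic-≤3 G cub four adjacent)
    where
    -- Only the first link can start at the current end `u`; then `hd` says that `x` was chosen
    -- different from its linking vertex.
    y≢u : y ≢ _
    y≢u eq = hd eq refl
    y≢v : y ≢ _
    y≢v refl = ne (edge-sym (removed m))
    four : Unique (y ∷ y₁ ∷ _ ∷ _ ∷ [])
    four = ((λ { refl → unique-head un (there (here refl)) }) ∷ y≢u ∷ y≢v ∷ [])
         ∷ ((λ { refl → u∉ (there (here refl)) }) ∷ (λ { refl → v∉ (there (here refl)) }) ∷ [])
         ∷ ((v≢u m ∘ sym) ∷ []) ∷ [] ∷ []
    adjacent : ∀ {z} → z ∈ y ∷ y₁ ∷ _ ∷ _ ∷ [] → Adj G _ z
    adjacent (here refl)                         = adj-comm G yx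
    adjacent (there (here refl))                 = adj-comm G y₁x
    adjacent (there (there (here refl)))         = adj-comm G ux
    adjacent (there (there (there (here refl)))) =
      edge-adj (ham p) (edge-sym (removed m))
  fresh cub p ux m (link yx y₁x cx e ne sg ch) un hd u∉ v∉ (there (here refl)) =
    bip _ _ y₁x (trans (chord-colour p ux) (sym cx))
  fresh cub p ux m (link yx y₁x cx e ne sg ch) un hd u∉ v∉ (there (there x∈)) =
    fresh cub p ux m ch (unique-tail (unique-tail un))
      (λ { refl → ⊥-elim (u∉ (there (here refl))) })
      (u∉ ∘ there ∘ there) (v∉ ∘ there ∘ there) x∈

  unique-length-≤ : ∀ {zs : List (Fin n)} → Unique zs → length zs ≤ n
  unique-length-≤ un = ℕ.≤-trans (unique-length un (λ _ → ∈-allFin _))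
                                 (ℕ.≤-reflexive (length-tabulate id))

  path-predecessor : ∀ {Q w} → PathTo w Q → ∃ λ q → ∀ {y} → EdgeP Q w y → y ≡ q
  path-predecessor p with ends p
  ... | L , refl with initLast L
  -- A one-vertex path has no edge; `t` is a default value.
  ...   | []       = t , λ e → ⊥-elim ([ ¬consec-[-] , ¬consec-[-] ]′ e)
  ...   | L′ ∷ʳ′ q = q , λ
    { (inj₁ e) → ⊥-elim (¬consec-last (L′ ++ [ q ]) (unique p) e)
    ; (inj₂ e) → consec-unique-pred (unique p) e (L′ , [] , ++-assoc L′ [ q ] _) }

  -- As long as the ends are new, each step lengthens the chain by two distinct vertices; at the
  -- first repetition `retreat` takes over. The bound counts double: `length zs` is twice the number
  -- of moves made so far. The last component excludes a return to any path that still had the edge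
  -- from `w` to `entry zs`.
  search : ∀ k {Q w zs} → Cubic G → Adj G s t → n ≤ length zs + k →
           PathTo w Q → Chain Q w zs → Unique (w ∷ zs) →
           (∀ {x} → Adj G w x → x ≢ entry zs → x ≢ t) →
           ∃₂ λ Q′ h → LollipopStep G s t Q Q′ × Tail Q Q′ h
             × (suc h + suc h) + length zs ≤ n + n
             × (∀ {Q⁻} → EdgeP Q⁻ w (entry zs) → ¬ EdgeP Q w (entry zs) → Q′ ≢ Q⁻)
  -- Without fuel, `w ∷ zs` would have more than n distinct entries.
  search zero cub st fuel p ch un nt = ⊥-elim (ℕ.<⇒≱ (unique-length-≤ un)
    (ℕ.≤-trans fuel (ℕ.≤-reflexive (ℕ.+-identityʳ _))))
  search (suc k) {Q} {w} {zs} cub st fuel p ch un nt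
    with path-predecessor p
  -- The edge to add avoids the path edge at `w` and the edge that the last move removed; initially
  -- the default `entry [] = t` rules out the deleted cycle edge.
  ... | q , only with cubic-third G cub w q (entry zs)
  ... | x , wx , x≢q , x≢e with move st p wx (nt wx x≢e) (x≢q ∘ only)
  ... | v , Q′ , m with v ∈? zs
  ...   | yes v∈ with subchain ch (end-colour (path m)) v∈
  -- `F` is the walk since the earlier visit to `v`; it is dropped, and the older moves are undone.
  ...     | F , zs′ , refl , ch′ with retreat st (path m) (keep-chain p m x∉ ch′) un′ x∉
                                        (removed m) (removed-gone m)
    where
    un′ : Unique (v ∷ zs′)
    un′ = unique-++ʳ F (unique-tail un)
    x∉ : x ∉ zs′
    x∉ = fresh cub p wx m ch′ un′ (⊥-elim ∘ v≢u m)
           (unique-head un ∘ ∈-++⁺ʳ F ∘ there) (unique-head un′)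
  ...       | h , T , h≤ = Q′ , h , step m , T , ℕ.+-mono-≤ bound (ℕ.<⇒≤ (unique-length-≤ un))
                         , λ e⁻ gone → no-return m wx e⁻ gone (x≢e ∘ sym)
    where
    bound : suc h + suc h ≤ n
    -- `w`, `v` and the at least 2h entries of `zs′` are distinct.
    bound = begin
      suc h + suc h             ≡⟨ cong suc (ℕ.+-suc h h) ⟩
      suc (suc (h + h))         ≤⟨ s≤s (s≤s h≤) ⟩
      suc (length (v ∷ zs′))    ≤⟨ s≤s (ℕ.m≤n+m (length (v ∷ zs′)) (length F)) ⟩
      suc (length F + length (v ∷ zs′)) ≡⟨ cong suc (length-++ F) ⟨
      length (w ∷ F ++ v ∷ zs′) ≤⟨ unique-length-≤ un ⟩
      n ∎
      where open ℕ.≤-Reasoning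
  search (suc k) {Q} {w} {zs} cub st fuel p ch un nt
      | q , only | x , wx , x≢q , x≢e | v , Q′ , m | no v∉ = result (adjacent? t v)
    where
    no-return′ : ∀ {Q⁻} → EdgeP Q⁻ w (entry zs) → ¬ EdgeP Q w (entry zs) → Q′ ≢ Q⁻
    no-return′ e⁻ gone = no-return m wx e⁻ gone (x≢e ∘ sym)
    x∉ : x ∉ zs
    x∉ = fresh cub p wx m ch un (λ _ → x≢e) (unique-head un) v∉
    cx : c x ≡ c t
    cx = chord-colour p wx
    ch′ : Chain Q′ v (x ∷ w ∷ zs)
    ch′ = link (edge-adj (ham p) (removed m)) wx cx
            (from (edges m x w) (inj₂ (inj₂ (refl , refl)) ,
              λ { (inj₁ (refl , _)) → end-colour (path m) cx ; (inj₂ (_ , eq)) → v≢u m (sym eq) }))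
            (removed-gone m ∘ edge-sym) (sym (equal-sign m)) (keep-chain p m x∉ ch)
    un′ : Unique (v ∷ x ∷ w ∷ zs)
    un′ = unique-cons
            (λ { (here refl) → end-colour (path m) cx
               ; (there (here eq)) → v≢u m eq
               ; (there (there v∈)) → v∉ v∈ })
            (unique-cons
              (λ { (here refl) → end-colour p cx ; (there x∈) → x∉ x∈ }) un)
    fuel′ : n ≤ suc (suc (length zs)) + k
    fuel′ = ℕ.m≤n⇒m≤1+n (ℕ.≤-trans fuel (ℕ.≤-reflexive (ℕ.+-suc (length zs) k)))
    result : Dec (Adj G t v) → ∃₂ λ Q′ h → LollipopStep G s t Q Q′ × Tail Q Q′ h
             × (suc h + suc h) + length zs ≤ n + n
             × (∀ {Q⁻} → EdgeP Q⁻ w (entry zs) → ¬ EdgeP Q w (entry zs) → Q′ ≢ Q⁻)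
    result (yes tv) = Q′ , 0 , step m , stop (ends (path m)) tv
                    , ℕ.+-mono-≤ (ℕ.≤-trans (s≤s z≤n) (unique-length-≤ un)) (unique-length-≤ un)
                    , no-return′
    result (no ntv)
      -- Since `v` is not adjacent to `t`, no edge at `v` leads to `t`.
      with search k cub st fuel′ (path m) ch′ un′ (λ { vt _ refl → ntv (adj-comm G vt) })
    ... | Q″ , h , st′ , T , bound , nr = Q′ , suc h , step m
        , go (ends (path m)) ntv st′ (nr (removed m) (removed-gone m)) T
        -- The two units for the present step are those by which the chain has grown.
        , ℕ.≤-trans (ℕ.≤-reflexive (solve 2 (λ a b →
              (con 2 :+ a) :+ (con 2 :+ a) :+ b := (con 1 :+ a) :+ (con 1 :+ a) :+ (con 2 :+ b))
              refl h (length zs))) bound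
        , no-return′
      where open +-*-Solver

-- From the Hamiltonian cycle to the initial path

halve-≤ : ∀ {a b} → a + a ≤ b + b → a ≤ b
halve-≤ 2a≤2b = ℕ.≮⇒≥ λ b<a → ℕ.<⇒≱ (ℕ.+-mono-< b<a b<a) 2a≤2b

theorem1p3 : ∀ {n} (G : Graph n) → Cubic G → Bipartite G → Pfaffian G →
    ∀ (H : List (Fin n)) → IsHamCycle G H →
    ∀ (s t : Fin n) → EdgeC H s t →
    Σ ℕ λ h → Σ (ℕ → List (Fin n)) λ Q → LollipopRun G H s t h Q × h ≤ n
theorem1p3 {n} G cub (c , bip) (D , pf) H ((3≤ , unH , adjH) , allH) s t est
  with rotate-to-edge H 3≤ est
... | r , perm , same with initLast r
...   | [] = ⊥-elim (ℕ.<⇒≱ (s≤s ℕ.≤-refl) (ℕ.≤-trans 3≤ (ℕ.≤-reflexive (sym (↭-length perm)))))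
...   | R ∷ʳ′ u = conclude
    where
    -- The rotated cycle read as a path: only its closing edge ut is missing.
    Q₀ = t ∷ s ∷ R ++ [ u ]
    un : Unique Q₀
    un = Unique-resp-↭ (↭-sym perm) unH
    close≡ : close Q₀ ≡ (t ∷ s ∷ R) ++ u ∷ t ∷ []
    close≡ = ++-assoc (t ∷ s ∷ R) [ u ] [ t ]
    path⇒cycle : ∀ {a b} → EdgeP Q₀ a b → EdgeC H a b
    path⇒cycle {a} {b} e = to (same a b)
      (subst (λ l → EdgeP l a b) (sym close≡) (edge-join (t ∷ s ∷ R) e))
    adjC : ∀ {a b} → EdgeC H a b → Adj G a b
    adjC (inj₁ e) = adjH _ _ e
    adjC (inj₂ e) = adj-comm G (adjH _ _ e)
    hamQ : IsHamPath G Q₀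
    hamQ = un , (λ v → ∈-resp-↭ (↭-sym perm) (allH v)) , λ a b → adjC ∘ path⇒cycle ∘ inj₁
    anchoredQ : Anchored G s t Q₀
    anchoredQ = hamQ , R ++ [ u ] , refl
    tu : EdgeC H t u
    tu = to (same t u) (subst (λ l → EdgeP l t u) (sym close≡)
           (edge-++ʳ (t ∷ s ∷ R) (inj₂ ([] , [] , refl))))
    u≢s : u ≢ s
    u≢s refl = unique-head (unique-tail un) (∈-++⁺ʳ R (here refl))
    open-end : ¬ EdgeP Q₀ t u
    open-end (inj₁ e) = u≢s (consec-unique-succ un e ([] , _ , refl))
    open-end (inj₂ e) = ¬consec-last (t ∷ s ∷ R) un e
    initial : IsInitial G H s t Q₀
    initial = anchoredQ , u , u≢s , tu , (t ∷ s ∷ R , refl) , λ a b → mk⇔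
      (λ e → path⇒cycle e ,
        λ { (inj₁ (refl , refl)) → open-end e ; (inj₂ (refl , refl)) → open-end (edge-sym e) })
      (λ { (e , ne) → [ id , (λ e′ → ⊥-elim (chord a b ne e′)) ]′ (edge-split (t ∷ s ∷ R)
             (subst (λ l → EdgeP l a b) close≡ (from (same a b) e))) })
      where
      chord : ∀ a b → ¬ UEq a b t u → ¬ EdgeP (u ∷ t ∷ []) a b
      chord a b ne e with edge-∷⁻ e
      ... | inj₁ (inj₁ (p , q)) = ne (inj₂ (p , q))
      ... | inj₁ (inj₂ (p , q)) = ne (inj₁ (p , q))
      ... | inj₂ e′             = [ ¬consec-[-] , ¬consec-[-] ]′ e′
    f = proj₁ (potential D Q₀ un _≟_)
    f-pot : ∀ {y z} → Consec Q₀ y z → f y xor f z ≡ D y z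
    f-pot = proj₂ (potential D Q₀ un _≟_)
    open Lollipop G c bip D pf f s t
    open xor-∧-Solver
    -- The potential cancels the value at `b`: the sign is `f a` towards the predecessor and its
    -- negation towards the successor.
    before : ∀ {a b} → Consec Q₀ b a → τ a b ≡ f a
    before {a} {b} e = trans (cong (f b xor_) (sym (f-pot e)))
      (solve 2 (λ p q → p :+ (p :+ q) := q) refl (f b) (f a))
    after : ∀ {a b} → Consec Q₀ a b → τ a b ≡ not (f a)
    after {a} {b} e = trans
      (cong (f b xor_) (trans (reverse-arc (adj-comm G (adjC (path⇒cycle (inj₁ e)))))
                              (cong not (sym (f-pot e)))))
      (solve 2 (λ p q → p :+ (con true :+ (q :+ p)) := con true :+ q) refl (f b) (f a))
    alternatingQ : Alternating Q₀
    alternatingQ _ b≢b′ (inj₁ e) (inj₁ e′) eq = b≢b′ (consec-unique-succ un e e′)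
    alternatingQ _ b≢b′ (inj₂ e) (inj₂ e′) eq = b≢b′ (consec-unique-pred un e e′)
    alternatingQ _ b≢b′ (inj₁ e) (inj₂ e′) eq =
      not-¬ refl (trans (sym (before e′)) (trans (sym eq) (after e)))
    alternatingQ _ b≢b′ (inj₂ e) (inj₁ e′) eq =
      not-¬ refl (trans (sym (before e)) (trans eq (after e′)))
    conclude : Σ ℕ λ h → Σ (ℕ → List (Fin n)) λ Q → LollipopRun G H s t h Q × h ≤ n
    -- The chain is empty, so fuel n suffices, and u is a neighbour of `t` by the deleted edge.
    conclude with search n {zs = []} cub (adjC est) ℕ.≤-refl
        (record { anchored = anchoredQ ; ends = t ∷ s ∷ R , refl
                ; end-colour = bip t u (adjC tu) ∘ sym ; alternating = alternatingQ })
        (base (adjC tu)) ([] ∷ []) (λ _ → id)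
    ... | _ , h , st , T , bound , _ = suc h , sequence T , tail-run initial st T
        , halve-≤ (subst (_≤ n + n) (ℕ.+-identityʳ (suc h + suc h)) bound)
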